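{- For every $n \ge 1$, the fan graph $F_n = K_1 \vee P_n$ satisfies $l(-F_n) = l_{\max}(F_n) = \left\lfloor \frac{n}{2} \right\rfloor$.
   Context: All graphs are finite, simple and undirected. A signed graph $\Sigma=(G,\sigma)$ is a graph $G$ with a signature $\sigma:E(G)\to\{+1,-1\}$. The sign of a cycle is the product of the signs of its edges; $\Sigma$ is balanced if all its cycles are positive. The frustration index $l(\Sigma)$ is the minimum number of edges whose deletion makes $\Sigma$ balanced. $-G$ is $G$ with all edges signed $-1$. $l_{\max}(G)=\max_\sigma l(G,\sigma)$ over all signatures of $G$. $P_n$ is the path on $n$ vertices and $\vee$ denotes the join of vertex-disjoint graphs. -}

module Defs where

open import Data.Bool.Base using (Bool; true; false; _∧_; _∨_; not; T)
open import Data.Bool.Properties using (T?; T-∧; ∨-comm)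
open import Data.Fin.Base using (Fin; toℕ; splitAt)
open import Data.Fin.Properties using (_≟_; _<?_)
open import Data.List.Base using (List; []; _∷_; length; filter; allFin; cartesianProduct)
open import Data.List.Relation.Unary.Unique.Propositional using (Unique)
open import Data.Nat.Base using (ℕ; zero; suc; _+_; _≤_; _≡ᵇ_)
open import Data.Product.Base using (_×_; _,_; proj₁; ∃-syntax)
open import Data.Sign.Base using (Sign; _*_) renaming (+ to pos; - to neg)
open import Data.Sum.Base using (_⊎_; inj₁; inj₂)
open import Function.Base using (_∘_)
open import Function.Bundles using (Equivalence)
open import Relation.Binary.PropositionalEquality
  using (_≡_; refl; sym; cong; cong₂)
open import Relation.Nullary.Decidable using (yes; no; ⌊_⌋; _×-dec_)
open import Relation.Nullary.Negation using (contradiction)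
open import Relation.Unary using (Pred)
open import Level using (0ℓ)

record Graph (n : ℕ) : Set where
  field
    adj      : Fin n → Fin n → Bool
    adj-sym  : ∀ u v → adj u v ≡ adj v u
    loopless : ∀ u → adj u u ≡ false

  Adj : Fin n → Fin n → Set
  Adj u v = T (adj u v)

  -- Each edge is listed once, with its smaller endpoint first.
  edges : List (Fin n × Fin n)
  edges = filter (λ (u , v) → (u <? v) ×-dec T? (adj u v))
                 (cartesianProduct (allFin n) (allFin n))

  size : ℕ
  size = length edges

open Graph public

K : ∀ n → Graph n
K n = record
  { adj      = λ u v → not ⌊ u ≟ v ⌋
  ; adj-sym  = symmetric
  ; loopless = irreflexive
  }
  where
  symmetric : ∀ u v → not ⌊ u ≟ v ⌋ ≡ not ⌊ v ≟ u ⌋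
  symmetric u v with u ≟ v | v ≟ u
  ... | yes _ | yes _ = refl
  ... | no  _ | no  _ = refl
  ... | yes p | no ¬q = contradiction (sym p) ¬q
  ... | no ¬p | yes q = contradiction (sym q) ¬p

  irreflexive : ∀ u → not ⌊ u ≟ u ⌋ ≡ false
  irreflexive u with u ≟ u
  ... | yes _ = refl
  ... | no ¬p = contradiction refl ¬p

P : ∀ n → Graph n
P n = record
  { adj      = λ u v → step (toℕ u) (toℕ v) ∨ step (toℕ v) (toℕ u)
  ; adj-sym  = λ u v → ∨-comm (step (toℕ u) (toℕ v)) (step (toℕ v) (toℕ u))
  ; loopless = λ u → cong₂ _∨_ (no-step (toℕ u)) (no-step (toℕ u))
  }
  where
  step : ℕ → ℕ → Bool
  step i j = suc i ≡ᵇ j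

  no-step : ∀ i → step i i ≡ false
  no-step zero    = refl
  no-step (suc i) = no-step i

infixr 6 _⋁_

-- The first m vertices carry G and the last n carry H.
_⋁_ : ∀ {m n} → Graph m → Graph n → Graph (m + n)
_⋁_ {m} {n} G H = record
  { adj      = λ u v → joined (splitAt m u) (splitAt m v)
  ; adj-sym  = λ u v → symmetric (splitAt m u) (splitAt m v)
  ; loopless = λ u → irreflexive (splitAt m u)
  }
  where
  joined : Fin m ⊎ Fin n → Fin m ⊎ Fin n → Bool
  joined (inj₁ u) (inj₁ v) = adj G u v
  joined (inj₂ u) (inj₂ v) = adj H u v
  joined (inj₁ _) (inj₂ _) = true
  joined (inj₂ _) (inj₁ _) = true

  symmetric : ∀ x y → joined x y ≡ joined y x
  symmetric (inj₁ u) (inj₁ v) = adj-sym G u v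
  symmetric (inj₂ u) (inj₂ v) = adj-sym H u v
  symmetric (inj₁ _) (inj₂ _) = refl
  symmetric (inj₂ _) (inj₁ _) = refl

  irreflexive : ∀ x → joined x x ≡ false
  irreflexive (inj₁ u) = loopless G u
  irreflexive (inj₂ u) = loopless H u

F : ∀ n → Graph (1 + n)
F n = K 1 ⋁ P n

-- sign-sym makes the sign depend only on the unordered pair {u , v}; since Adj
-- is proposition-valued, a signature is exactly a function E(G) → {+1, -1}.
record Signature {n} (G : Graph n) : Set where
  field
    sign     : ∀ u v → Adj G u v → Sign
    sign-sym : ∀ {u v} (e : Adj G u v) (e′ : Adj G v u) → sign u v e ≡ sign v u e′

open Signature public

record SignedGraph (n : ℕ) : Set where
  constructor _,_
  field
    graph     : Graph n
    signature : Signature graph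

open SignedGraph public

infix 8 -_

-_ : ∀ {n} → Graph n → SignedGraph n
- G = G , record { sign = λ _ _ _ → neg ; sign-sym = λ _ _ → refl }

module _ {n} (G : Graph n) where

  infixr 5 _∷_

  data Walk : Fin n → Fin n → Set where
    []  : ∀ {u} → Walk u u
    _∷_ : ∀ {u v w} → Adj G u v → Walk v w → Walk u w

  vertices : ∀ {u v} → Walk u v → List (Fin n)
  vertices {u} []      = u ∷ []
  vertices {u} (_ ∷ p) = u ∷ vertices p

  -- A path on at least three vertices, closed up by one more edge.
  record Cycle : Set where
    field
      {start end} : Fin n
      path        : Walk start end
      distinct    : Unique (vertices path)
      long        : 3 ≤ length (vertices path)
      closing     : Adj G end start

module _ {n} (S : SignedGraph n) where

  walkSign : ∀ {u v} → Walk (graph S) u v → Sign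
  walkSign []                = pos
  walkSign (_∷_ {u} {v} e p) = sign (signature S) u v e * walkSign p

  cycleSign : Cycle (graph S) → Sign
  cycleSign c = walkSign path * sign (signature S) end start closing
    where open Cycle c

  Balanced : Set
  Balanced = ∀ c → cycleSign c ≡ pos

-- A set of edges of G, given as the spanning subgraph formed by those edges.
record EdgeSet {n} (G : Graph n) : Set where
  field
    members : Graph n
    within  : ∀ u v → Adj members u v → Adj G u v

open EdgeSet public

∣_∣ : ∀ {n} {G : Graph n} → EdgeSet G → ℕ
∣ D ∣ = size (members D)

delete : ∀ {n} (G : Graph n) → EdgeSet G → Graph n
delete G D = record
  { adj      = λ u v → adj G u v ∧ not (adj (members D) u v)
  ; adj-sym  = λ u v → cong₂ (λ a b → a ∧ not b) (adj-sym G u v) (adj-sym (members D) u v)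
  ; loopless = λ u → cong (_∧ not (adj (members D) u u)) (loopless G u)
  }

infixl 6 _∖_

_∖_ : ∀ {n} (S : SignedGraph n) → EdgeSet (graph S) → SignedGraph n
S ∖ D = delete (graph S) D , record
  { sign     = λ u v e → sign (signature S) u v (kept e)
  ; sign-sym = λ e e′ → sign-sym (signature S) (kept e) (kept e′)
  }
  where
  kept : ∀ {u v} → Adj (delete (graph S) D) u v → Adj (graph S) u v
  kept = proj₁ ∘ Equivalence.to T-∧

IsMinimum : Pred ℕ 0ℓ → ℕ → Set
IsMinimum A k = A k × (∀ m → A m → k ≤ m)

IsMaximum : Pred ℕ 0ℓ → ℕ → Set
IsMaximum A k = A k × (∀ m → A m → m ≤ k)

-- IsMinimum and IsMaximum determine k uniquely, so the two relations below are
-- the graphs of l and l_max:  l[ S ]≡ k  says l(S) = k,  lmax[ G ]≡ k  says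
-- l_max(G) = k.
l[_]≡_ : ∀ {n} → SignedGraph n → ℕ → Set
l[ S ]≡ k = IsMinimum (λ m → ∃[ D ] Balanced (S ∖ D) × ∣ D ∣ ≡ m) k

lmax[_]≡_ : ∀ {n} → Graph n → ℕ → Set
lmax[ G ]≡ k = IsMaximum (λ m → ∃[ σ ] l[ (G , σ) ]≡ m) k

{-# OPTIONS --safe #-}

-- Upper bound: the path has a potential, so only spokes can be frustrated. The
-- two signs available to the hub frustrate complementary sets of spokes, and one
-- of these has at most ⌊ n /2⌋ elements. Lower bound: the hub together with the
-- path vertices 2i and 2i + 1 spans, for i < ⌊ n /2⌋, pairwise edge-disjoint
-- triangles, all negative in - F n, so every balancing deletion meets each of them.
module Submission where

open import Defs
open import Data.Bool.Base using (Bool; true; false; not; T)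
open import Data.Bool.Properties using (T?; T-∧)
open import Data.Fin.Base using (Fin; zero; suc; toℕ) renaming (_<_ to _<ᶠ_)
open import Data.Fin.Properties using (_<?_; toℕ-injective; injective⇒≤; suc-injective)
open import Data.List.Base using (List; _++_; length; map; lookup; allFin; cartesianProduct)
open import Data.List.Membership.Propositional using (_∈_)
open import Data.List.Membership.Propositional.Properties
  using (∈-lookup; ∈-++⁻; ∈-map⁺; ∈-allFin; ∈-filter⁺; ∈-filter⁻; ∈-cartesianProduct⁺)
open import Data.List.Properties using (length-++; length-map; length-tabulate)
open import Data.List.Relation.Binary.Subset.Propositional using (_⊆_)
import Data.List.Relation.Unary.All as All
open import Data.List.Relation.Unary.AllPairs using ([]; _∷_)
open import Data.List.Relation.Unary.All using ([]; _∷_)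
open import Data.List.Relation.Unary.Any using (index)
open import Data.List.Relation.Unary.Any.Properties using (lookup-index)
open import Data.List.Relation.Unary.Unique.Propositional using (Unique)
open import Data.List.Relation.Unary.Unique.Propositional.Properties
  using (++⁺; filter⁺; cartesianProduct⁺; allFin⁺)
open import Data.Nat.Base using (ℕ; zero; suc; _+_; _≤_; ⌊_/2⌋; z<s; s<s)
open import Data.Nat.Properties
  using (≤-total; ≤-trans; ≤-antisym; ≤-refl; +-monoʳ-≤; +-monoˡ-≤; ⌊n/2⌋-mono; n≡⌊n+n/2⌋;
         module ≤-Reasoning)
open import Data.Product.Base using (_×_; _,_; proj₁; proj₂; ∃-syntax)
open import Data.Sign.Base using (Sign; opposite; _*_) renaming (+ to pos; - to neg)
open import Data.Sign.Properties
  using (_≟_; *-assoc; *-comm; *-identityʳ; s*s≡+)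
open import Data.Sum.Base using (_⊎_; inj₁; inj₂)
open import Function.Base using (_∘_)
open import Function.Bundles using (Equivalence)
open import Function.Definitions using (Injective)
open import Relation.Binary.PropositionalEquality
  using (_≡_; _≢_; refl; sym; trans; cong; cong₂; subst; module ≡-Reasoning)
open import Relation.Nullary.Decidable using (yes; no; ⌊_⌋; toWitness; fromWitness; _×-dec_)
open import Relation.Nullary.Negation using (¬_; contradiction)

-- Counting with duplicate-free lists.

lookup-injective : ∀ {A : Set} {xs : List A} → Unique xs → Injective _≡_ _≡_ (lookup xs)
lookup-injective (_ ∷ _)   {zero}  {zero}  _  = refl
lookup-injective (x≢ ∷ _)  {zero}  {suc j} eq = contradiction eq (All.lookup x≢ (∈-lookup j))
lookup-injective (x≢ ∷ _)  {suc i} {zero}  eq = contradiction (sym eq) (All.lookup x≢ (∈-lookup i))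
lookup-injective (_ ∷ xs!) {suc i} {suc j} eq = cong suc (lookup-injective xs! eq)

index-injective : ∀ {A : Set} {x y : A} {xs} (p : x ∈ xs) (q : y ∈ xs) → index p ≡ index q → x ≡ y
index-injective {xs = xs} p q eq =
  trans (lookup-index p) (trans (cong (lookup xs) eq) (sym (lookup-index q)))

-- Sending each position of `xs` to a position of the same element in `ys` is an injection between
-- the index sets.
Unique-⊆⇒length≤ : ∀ {A : Set} {xs ys : List A} → Unique xs → xs ⊆ ys → length xs ≤ length ys
Unique-⊆⇒length≤ xs! xs⊆ys = injective⇒≤ λ {i} {j} eq →
  lookup-injective xs!
    (index-injective (xs⊆ys (∈-lookup i)) (xs⊆ys (∈-lookup j)) eq)

-- Twice the smaller summand is at most `n`, and halving is monotone.
≤⌊/2⌋-either : ∀ a b {n} → a + b ≤ n → a ≤ ⌊ n /2⌋ ⊎ b ≤ ⌊ n /2⌋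
≤⌊/2⌋-either a b {n} a+b≤n with ≤-total a b
... | inj₁ a≤b = inj₁ (subst (_≤ ⌊ n /2⌋) (sym (n≡⌊n+n/2⌋ a))
                        (⌊n/2⌋-mono (≤-trans (+-monoʳ-≤ a a≤b) a+b≤n)))
... | inj₂ b≤a = inj₂ (subst (_≤ ⌊ n /2⌋) (sym (n≡⌊n+n/2⌋ b))
                        (⌊n/2⌋-mono (≤-trans (+-monoˡ-≤ b b≤a) a+b≤n)))

-- Arithmetic of signs and Booleans.

*-cancel-middle : ∀ a b c → (a * b) * (b * c) ≡ a * c
*-cancel-middle a b c = begin
  (a * b) * (b * c)  ≡⟨ *-assoc a b (b * c) ⟩
  a * (b * (b * c))  ≡⟨ cong (a *_) (*-assoc b b c) ⟨
  a * ((b * b) * c)  ≡⟨ cong (λ s → a * (s * c)) (s*s≡+ b) ⟩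
  a * c              ∎
  where open ≡-Reasoning

*-transpose : ∀ {a b c} → a * b ≡ c → a ≡ c * b
*-transpose {a} {b} {c} eq = begin
  a            ≡⟨ *-identityʳ a ⟨
  a * pos      ≡⟨ cong (a *_) (s*s≡+ b) ⟨
  a * (b * b)  ≡⟨ *-assoc a b b ⟨
  (a * b) * b  ≡⟨ cong (_* b) eq ⟩
  c * b        ∎
  where open ≡-Reasoning

≢⇒≡opposite : ∀ {s t} → s ≢ t → s ≡ opposite t
≢⇒≡opposite {pos} {pos} s≢t = contradiction refl s≢t
≢⇒≡opposite {pos} {neg} _   = refl
≢⇒≡opposite {neg} {pos} _   = refl
≢⇒≡opposite {neg} {neg} s≢t = contradiction refl s≢t

¬T⇒T-not : ∀ {b} → ¬ T b → T (not b)
¬T⇒T-not {false} _  = _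
¬T⇒T-not {true}  ¬t = ¬t _

T-not⇒¬T : ∀ {b} → T (not b) → ¬ T b
T-not⇒¬T {false} _ ()

-- Edge lists and edge deletion.

module _ {n} (G : Graph n) where

  edges-unique : Unique (edges G)
  edges-unique = filter⁺ (λ (u , v) → (u <? v) ×-dec T? (adj G u v))
                         (cartesianProduct⁺ (allFin⁺ n) (allFin⁺ n))

  ∈-edges⁺ : ∀ {u v} → u <ᶠ v → Adj G u v → (u , v) ∈ edges G
  ∈-edges⁺ u<v e = ∈-filter⁺ (λ (u , v) → (u <? v) ×-dec T? (adj G u v))
                             (∈-cartesianProduct⁺ (∈-allFin _) (∈-allFin _)) (u<v , e)

  ∈-edges⁻ : ∀ {u v} → (u , v) ∈ edges G → u <ᶠ v × Adj G u v
  ∈-edges⁻ = proj₂ ∘ ∈-filter⁻ (λ (u , v) → (u <? v) ×-dec T? (adj G u v))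
                               {xs = cartesianProduct (allFin n) (allFin n)}

  delete-adj⁺ : ∀ D {u v} → Adj G u v → ¬ Adj (members D) u v → Adj (delete G D) u v
  delete-adj⁺ D e e∉D = Equivalence.from T-∧ (e , ¬T⇒T-not e∉D)

  delete-adj⁻ : ∀ D {u v} → Adj (delete G D) u v → ¬ Adj (members D) u v
  delete-adj⁻ D {u} {v} e = T-not⇒¬T (proj₂ (Equivalence.to (T-∧ {adj G u v}) e))

-- Potentials, balance, and signed paths.

module _ {n} {G : Graph n} where

  -- A potential is a switching function that makes every edge positive.
  Potential : Signature G → (Fin n → Sign) → Set
  Potential σ t = ∀ u v (e : Adj G u v) → sign σ u v e ≡ t u * t v

  -- Signs telescope along a walk: each inner vertex contributes the square of its value, so only
  -- the two ends remain. Closing the walk squares those as well.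
  potential⇒balanced : ∀ {σ t} → Potential σ t → Balanced (G , σ)
  potential⇒balanced {σ} {t} pot c = begin
    walkSign (G , σ) path * sign σ end start closing
      ≡⟨ cong₂ _*_ (walkSign-potential path) (pot end start closing) ⟩
    (t start * t end) * (t end * t start)
      ≡⟨ *-cancel-middle (t start) (t end) (t start) ⟩
    t start * t start
      ≡⟨ s*s≡+ (t start) ⟩
    pos ∎
    where
    open ≡-Reasoning
    open Cycle c

    walkSign-potential : ∀ {u v} (p : Walk G u v) → walkSign (G , σ) p ≡ t u * t v
    walkSign-potential {u} []                    = sym (s*s≡+ (t u))
    walkSign-potential {u} {w} (_∷_ {v = v} e p) =
      trans (cong₂ _*_ (pot u v e) (walkSign-potential p)) (*-cancel-middle (t u) (t v) (t w))

path-tail : ∀ {n} → Signature (P (suc n)) → Signature (P n)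
path-tail σ = record { sign = λ u v → sign σ (suc u) (suc v) ; sign-sym = sign-sym σ }

-- The new end vertex lies on a single edge, so its value can be chosen to give that edge the right
-- sign without disturbing the rest.
extend-potential : ∀ {n} (σ : Signature (P (2 + n))) →
                   ∃[ t ] Potential (path-tail σ) t → ∃[ t ] Potential σ t
extend-potential {n} σ (t′ , pot′) = t , pot
  where
  t : Fin (2 + n) → Sign
  t zero    = sign σ zero (suc zero) _ * t′ zero
  t (suc i) = t′ i

  first : sign σ zero (suc zero) _ ≡ t zero * t (suc zero)
  first = *-transpose refl

  pot : Potential σ t
  pot zero       (suc zero) _ = first
  pot (suc zero) zero       e =
    trans (sign-sym σ e _) (trans first (*-comm (t zero) (t (suc zero))))
  pot (suc u)    (suc v)    e = pot′ u v e

path-potential : ∀ n (σ : Signature (P n)) → ∃[ t ] Potential σ t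
path-potential zero          σ = (λ ()) , λ ()
path-potential (suc zero)    σ = (λ _ → pos) , λ { zero zero () }
path-potential (suc (suc n)) σ = extend-potential σ (path-potential (suc n) (path-tail σ))

-- Sets of spokes, given by their rim ends.

spokes : ∀ {n} → (Fin n → Bool) → EdgeSet (F n)
spokes {n} p = record
  { members = record { adj = spoke ; adj-sym = spoke-sym ; loopless = spoke-loopless }
  ; within  = spoke-within
  }
  where
  spoke : Fin (suc n) → Fin (suc n) → Bool
  spoke zero    (suc j) = p j
  spoke (suc i) zero    = p i
  spoke zero    zero    = false
  spoke (suc _) (suc _) = false

  spoke-sym : ∀ u v → spoke u v ≡ spoke v u
  spoke-sym zero    zero    = refl
  spoke-sym zero    (suc _) = refl
  spoke-sym (suc _) zero    = refl
  spoke-sym (suc _) (suc _) = refl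

  spoke-loopless : ∀ u → spoke u u ≡ false
  spoke-loopless zero    = refl
  spoke-loopless (suc _) = refl

  spoke-within : ∀ u v → T (spoke u v) → Adj (F n) u v
  spoke-within zero    (suc _) _ = _
  spoke-within (suc _) zero    _ = _

-- The hub is vertex `zero`, the smallest, so the ordering in `edges` always puts it first and
-- excludes the reversed pair.
∈-spokes⁻ : ∀ {n} (p : Fin n → Bool) {e} → e ∈ edges (members (spokes p)) →
            ∃[ j ] e ≡ (zero , suc j) × T (p j)
∈-spokes⁻ p {u , v} e∈ with u | v | ∈-edges⁻ (members (spokes p)) e∈
... | zero  | suc j | _ , pj = j , refl , pj
... | suc _ | zero  | () , _

-- The two edge lists, concatenated, stay duplicate-free and lie inside the list of all `n` spokes.
disjoint-spokes : ∀ {n} (p q : Fin n → Bool) → (∀ j → T (p j) → ¬ T (q j)) →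
                  ∣ spokes p ∣ + ∣ spokes q ∣ ≤ n
disjoint-spokes {n} p q p#q = begin
  length ps + length qs                        ≡⟨ length-++ ps ⟨
  length (ps ++ qs)                            ≤⟨ Unique-⊆⇒length≤ unique ⊆-spokes ⟩
  length (map spoke (allFin n))                ≡⟨ length-map spoke (allFin n) ⟩
  length (allFin n)                            ≡⟨ length-tabulate _ ⟩
  n                                            ∎
  where
  open ≤-Reasoning

  ps qs : List (Fin (suc n) × Fin (suc n))
  ps = edges (members (spokes p))
  qs = edges (members (spokes q))

  spoke : Fin n → Fin (suc n) × Fin (suc n)
  spoke j = zero , suc j

  disjoint : ∀ {e} → ¬ (e ∈ ps × e ∈ qs)
  disjoint (e∈ps , e∈qs) with ∈-spokes⁻ p e∈ps | ∈-spokes⁻ q e∈qs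
  ... | j , refl , pj | .j , refl , qj = p#q j pj qj

  unique : Unique (ps ++ qs)
  unique = ++⁺ (edges-unique (members (spokes p))) (edges-unique (members (spokes q))) disjoint

  ⊆-spokes : ps ++ qs ⊆ map spoke (allFin n)
  ⊆-spokes e∈ with ∈-++⁻ ps e∈
  ... | inj₁ e∈ps with ∈-spokes⁻ p e∈ps
  ...   | j , refl , _ = ∈-map⁺ spoke (∈-allFin j)
  ⊆-spokes e∈ | inj₂ e∈qs with ∈-spokes⁻ q e∈qs
  ...   | j , refl , _ = ∈-map⁺ spoke (∈-allFin j)

-- Upper bound: deleting the frustrated spokes.

fan-rim : ∀ {n} → Signature (F n) → Signature (P n)
fan-rim σ = record { sign = λ u v → sign σ (suc u) (suc v) ; sign-sym = sign-sym σ }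

frustration-upper-bound : ∀ n (σ : Signature (F n)) →
                          ∃[ D ] Balanced ((F n , σ) ∖ D) × ∣ D ∣ ≤ ⌊ n /2⌋
frustration-upper-bound n σ = 
  choose (≤⌊/2⌋-either ∣ deleted pos ∣ ∣ deleted neg ∣
           (disjoint-spokes (meets pos) (meets neg) disjoint))
  where
  t : Fin n → Sign
  t = proj₁ (path-potential n (fan-rim σ))

  -- The sign of a spoke after switching by `t`, with the hub left unswitched.
  switched : Fin n → Sign
  switched j = sign σ zero (suc j) _ * t j

  meets : Sign → Fin n → Bool
  meets s j = ⌊ switched j ≟ s ⌋

  disjoint : ∀ j → T (meets pos j) → ¬ T (meets neg j)
  disjoint j p q with () ← trans (sym (toWitness p)) (toWitness q)

  deleted : Sign → EdgeSet (F n)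
  deleted s = spokes (meets s)

  balanced : ∀ s → Balanced ((F n , σ) ∖ deleted s)
  balanced s = potential⇒balanced {t = t⁺} pot
    where
    t⁺ : Fin (suc n) → Sign
    -- Every surviving spoke has switched sign different from `s`, hence `opposite s`; giving the
    -- hub this value satisfies all of them at once.
    t⁺ zero    = opposite s
    t⁺ (suc j) = t j

    spoke : ∀ j → ¬ T (meets s j) → sign σ zero (suc j) _ ≡ opposite s * t j
    spoke j ¬m = *-transpose (≢⇒≡opposite (¬m ∘ fromWitness))

    pot : Potential (signature ((F n , σ) ∖ deleted s)) t⁺
    pot zero    (suc j) e = spoke j (delete-adj⁻ (F n) (deleted s) {zero} {suc j} e)
    pot (suc i) zero    e =
      trans (sign-sym σ _ _)
            (trans (spoke i (delete-adj⁻ (F n) (deleted s) {suc i} {zero} e))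
                   (*-comm (opposite s) (t i)))
    -- Only spokes are deleted, and on the rim `t⁺` agrees with the path potential.
    pot (suc i) (suc j) e = proj₂ (path-potential n (fan-rim σ)) i j _

  choose : ∣ deleted pos ∣ ≤ ⌊ n /2⌋ ⊎ ∣ deleted neg ∣ ≤ ⌊ n /2⌋ →
           ∃[ D ] Balanced ((F n , σ) ∖ D) × ∣ D ∣ ≤ ⌊ n /2⌋
  choose (inj₁ ≤k) = deleted pos , balanced pos , ≤k
  choose (inj₂ ≤k) = deleted neg , balanced neg , ≤k

-- Lower bound: edge-disjoint negative triangles.

-- left n i and right n i are the path vertices 2i and 2i + 1.
left right : ∀ n → Fin ⌊ n /2⌋ → Fin n
left (suc (suc n)) zero    = zero
left (suc (suc n)) (suc i) = suc (suc (left n i))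
right (suc (suc n)) zero    = suc zero
right (suc (suc n)) (suc i) = suc (suc (right n i))

⌊left/2⌋ : ∀ n i → ⌊ toℕ (left n i) /2⌋ ≡ toℕ i
⌊left/2⌋ (suc (suc n)) zero    = refl
⌊left/2⌋ (suc (suc n)) (suc i) = cong suc (⌊left/2⌋ n i)

⌊right/2⌋ : ∀ n i → ⌊ toℕ (right n i) /2⌋ ≡ toℕ i
⌊right/2⌋ (suc (suc n)) zero    = refl
⌊right/2⌋ (suc (suc n)) (suc i) = cong suc (⌊right/2⌋ n i)

left<right : ∀ n i → left n i <ᶠ right n i
left<right (suc (suc n)) zero    = z<s
left<right (suc (suc n)) (suc i) = s<s (s<s (left<right n i))

left-adj-right : ∀ n i → Adj (P n) (left n i) (right n i)
left-adj-right (suc (suc n)) zero    = _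
left-adj-right (suc (suc n)) (suc i) = left-adj-right n i

-- A triangle has an odd number of edges, so with all edges negative its sign computes to `neg`.
surviving-triangle⇒unbalanced : ∀ {n} (D : EdgeSet (F n)) i j → Adj (P n) i j →
  ¬ Adj (members D) zero (suc i) → ¬ Adj (members D) zero (suc j) →
  ¬ Adj (members D) (suc i) (suc j) → ¬ Balanced (- F n ∖ D)
surviving-triangle⇒unbalanced {n} D i j ij 0i∉D 0j∉D ij∉D balanced =
  contradiction (balanced triangle) λ ()
  where
  i≢j : suc i ≢ suc j
  i≢j refl = subst T (loopless (P n) i) ij

  triangle : Cycle (delete (F n) D)
  triangle = record
    { start    = zero
    ; path     = delete-adj⁺ (F n) D {zero} {suc i} _ 0i∉D
               ∷ delete-adj⁺ (F n) D {suc i} {suc j} ij ij∉D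
               ∷ []
    ; distinct = ((λ ()) ∷ (λ ()) ∷ []) ∷ (i≢j ∷ []) ∷ [] ∷ []
    ; long     = ≤-refl
    ; closing  = delete-adj⁺ (F n) D {suc j} {zero} _
                   -- The closing edge runs back to the hub, whereas the hypothesis is oriented away
                   -- from it.
                   (0j∉D ∘ subst T (adj-sym (members D) (suc j) zero))
    }

-- The last component says that the edge belongs to the i-th triangle.
balancing-meets-triangle : ∀ n (D : EdgeSet (F n)) → Balanced (- F n ∖ D) → ∀ i →
  ∃[ u ] ∃[ j ] (u , suc j) ∈ edges (members D) × ⌊ toℕ j /2⌋ ≡ toℕ i
balancing-meets-triangle n D balanced i
  with T? (adj (members D) zero (suc (left n i)))
     | T? (adj (members D) zero (suc (right n i)))
     | T? (adj (members D) (suc (left n i)) (suc (right n i)))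
... | yes e | _     | _     = _ , _ , ∈-edges⁺ (members D) z<s e , ⌊left/2⌋ n i
... | no _  | yes e | _     = _ , _ , ∈-edges⁺ (members D) z<s e , ⌊right/2⌋ n i
... | no _  | no _  | yes e =
  _ , _ , ∈-edges⁺ (members D) (s<s (left<right n i)) e , ⌊right/2⌋ n i
... | no e₁ | no e₂ | no e₃ = contradiction balanced
  (surviving-triangle⇒unbalanced D (left n i) (right n i) (left-adj-right n i) e₁ e₂ e₃)

-- Each `i` is sent to the position of a deleted edge of the i-th triangle. This is injective: the
-- position determines the edge, and halving the path index of its second endpoint recovers `i`.
frustration-lower-bound : ∀ n (D : EdgeSet (F n)) → Balanced (- F n ∖ D) → ⌊ n /2⌋ ≤ ∣ D ∣
frustration-lower-bound n D balanced = injective⇒≤ {f = λ i → index (hit i)} λ {i} {i′} eq →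
  toℕ-injective (begin
    toℕ i                 ≡⟨ proj₂ (proj₂ (proj₂ (meets i))) ⟨
    ⌊ toℕ (rim i) /2⌋     ≡⟨ cong (λ j → ⌊ toℕ j /2⌋) (rim-cong eq) ⟩
    ⌊ toℕ (rim i′) /2⌋    ≡⟨ proj₂ (proj₂ (proj₂ (meets i′))) ⟩
    toℕ i′                ∎)
  where
  open ≡-Reasoning

  meets = balancing-meets-triangle n D balanced

  rim : Fin ⌊ n /2⌋ → Fin n
  rim i = proj₁ (proj₂ (meets i))

  hit : ∀ i → (proj₁ (meets i) , suc (rim i)) ∈ edges (members D)
  hit i = proj₁ (proj₂ (proj₂ (meets i)))

  rim-cong : ∀ {i i′} → index (hit i) ≡ index (hit i′) → rim i ≡ rim i′
  rim-cong {i} {i′} eq = suc-injective (cong proj₂ (index-injective (hit i) (hit i′) eq))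

-- Combining the bounds.

frustration-all-negative : ∀ n → l[ - F n ]≡ ⌊ n /2⌋
frustration-all-negative n with frustration-upper-bound n (signature (- F n))
... | D , balanced , ∣D∣≤k =
  -- The upper bound only gives an inequality for `D`; the lower bound, applied to the same `D`,
  -- makes it an equality.
  (D , balanced , ≤-antisym ∣D∣≤k (frustration-lower-bound n D balanced)) ,
  λ { _ (D′ , balanced′ , refl) → frustration-lower-bound n D′ balanced′ }

mainTheorem6 : (n : ℕ) → 1 ≤ n →
    (l[ - F n ]≡ ⌊ n /2⌋) × (lmax[ F n ]≡ ⌊ n /2⌋)
mainTheorem6 n _ =
  frustration-all-negative n ,
  (signature (- F n) , frustration-all-negative n) ,
  -- As the frustration index of `σ`, `m` is at most the size of any balancing deletion, in
  -- particular of the one from the upper bound.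
  λ { m (σ , _ , minimal) →
        let D , balanced , ∣D∣≤k = frustration-upper-bound n σ
        in  ≤-trans (minimal ∣ D ∣ (D , balanced , refl)) ∣D∣≤k }
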